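{- For any finite simple undirected graph $G$ of order $n\ge 1$ and maximum degree $\Delta$, $\kappa(G)\le \frac{n\Delta}{\Delta+1}$.
   Context: For a graph $G=(V,E)$ and $C\subseteq V$, let $Odd(C)=\{v\in V : |N(v)\cap C|\equiv 1 \pmod 2\}$, where $N(v)$ is the open neighborhood of $v$. A set $B\subseteq V$ is a weak odd dominated (WOD) set if there exists $C\subseteq V\setminus B$ with $B\subseteq Odd(C)$. $\kappa(G)$ is the maximum size of a WOD set of $G$. -}

module Defs where

open import Data.Fin.Base using (Fin)
open import Data.Fin.Subset
open import Data.Fin.Subset.Properties
  using (_⊆?_; anySubset?; ∣⊥∣≡0; ⊥⊆)
open import Data.List.Base using (List; []; _∷_; _++_; map; filter; allFin)
open import Data.List.Extrema.Nat
open import Data.List.Membership.Propositional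
  using (lose) renaming (_∈_ to _∈ₗ_)
open import Data.List.Membership.Propositional.Properties
  using (∈-allFin; ∈-map⁺; ∈-map⁻; ∈-++⁺ˡ; ∈-++⁺ʳ; ∈-filter⁺; ∈-filter⁻)
open import Data.List.Relation.Unary.Any using (here)
open import Data.Nat.Base using (ℕ; zero; suc; _≤_; _%_)
open import Data.Nat.Properties using (_≟_; ≤-reflexive)
open import Data.Product.Base using (∃; _×_; _,_; proj₂)
open import Data.Sum.Base using (inj₁; inj₂)
open import Data.Vec.Base using ([]; _∷_; tabulate)
open import Level using (0ℓ)
open import Relation.Binary.Core using (Rel)
open import Relation.Binary.Definitions using (Decidable; Symmetric; Irreflexive)
open import Relation.Binary.PropositionalEquality
  using (_≡_; refl; sym; trans; cong)
open import Relation.Nullary.Decidable using (Dec; does; _×-dec_)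

-- Adjacency is required to be decidable so that neighbourhoods are subsets
-- with a computable size; classically this is no restriction.
record Graph (n : ℕ) : Set₁ where
  infix 4 _~_ _~?_
  field
    _~_      : Rel (Fin n) 0ℓ
    _~?_     : Decidable _~_
    ~-sym    : Symmetric _~_
    ~-irrefl : Irreflexive _≡_ _~_

subsets : (n : ℕ) → List (Subset n)
subsets zero    = [] ∷ []
subsets (suc n) = map (outside ∷_) (subsets n) ++ map (inside ∷_) (subsets n)

∈-subsets : ∀ {n} (p : Subset n) → p ∈ₗ subsets n
∈-subsets []            = here refl
∈-subsets (outside ∷ p) = ∈-++⁺ˡ (∈-map⁺ (outside ∷_) (∈-subsets p))
∈-subsets (inside ∷ p)  =
  ∈-++⁺ʳ (map (outside ∷_) (subsets _)) (∈-map⁺ (inside ∷_) (∈-subsets p))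

module _ {n : ℕ} (G : Graph n) where
  open Graph G

  N : Fin n → Subset n
  N v = tabulate λ u → does (v ~? u)

  degree : Fin n → ℕ
  degree v = ∣ N v ∣

  -- The base value 0 only matters for the graph with no vertices.
  Δ : ℕ
  Δ = max 0 (map degree (allFin n))

  Odd : Subset n → Subset n
  Odd C = tabulate λ v → does (∣ N v ∩ C ∣ % 2 ≟ 1)

  WOD : Subset n → Set
  WOD B = ∃ λ C → C ⊆ ∁ B × B ⊆ Odd C

  WOD? : (B : Subset n) → Dec (WOD B)
  WOD? B = anySubset? λ C → (C ⊆? ∁ B) ×-dec (B ⊆? Odd C)

  -- The base value 0 never exceeds the true maximum, as ⊥ is a WOD set;
  -- see κ-attained.
  κ : ℕ
  κ = max 0 (map ∣_∣ (filter WOD? (subsets n)))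

  degree≤Δ : ∀ v → degree v ≤ Δ
  degree≤Δ v = v≤max⁺ 0 _
    (inj₂ (lose (∈-map⁺ degree (∈-allFin v)) (≤-reflexive refl)))

  κ-upper : ∀ B → WOD B → ∣ B ∣ ≤ κ
  κ-upper B wod = v≤max⁺ 0 _ (inj₂ (lose
    (∈-map⁺ ∣_∣ (∈-filter⁺ WOD? (∈-subsets B) wod)) (≤-reflexive refl)))

  κ-attained : ∃ λ B → WOD B × ∣ B ∣ ≡ κ
  κ-attained with argmax-sel (λ k → k) 0 (map ∣_∣ (filter WOD? (subsets n)))
  ... | inj₁ κ≡0 = ⊥ , (⊥ , ⊥⊆ , ⊥⊆) , trans (∣⊥∣≡0 n) (sym κ≡0)
  ... | inj₂ κ∈  with ∈-map⁻ ∣_∣ κ∈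
  ...   | B , B∈ , κ≡∣B∣ = B , proj₂ (∈-filter⁻ WOD? {xs = subsets n} B∈) , sym κ≡∣B∣

{-# OPTIONS --safe #-}

-- If C witnesses that B is WOD, then every vertex of B has an odd, hence
-- nonzero, number of neighbours in C, so the neighbourhoods of the vertices of
-- C cover B.  As C avoids B, this gives ∣B∣ ≤ ∣C∣ Δ ≤ (n ∸ ∣B∣) Δ.
module Submission where

open import Defs
open import Data.Nat.Base as ℕ using (ℕ; suc)
open import Data.Integer.Base using (+_)
open import Data.Rational.Base using (_/_; _≤_)

open import Data.Fin.Base using (Fin; zero; suc)
open import Data.Fin.Subset
open import Data.Fin.Subset.Properties
import Data.Integer.Base as ℤ
import Data.Integer.Properties as ℤ
open import Data.Nat.Properties
  using ( _≟_; ≤-reflexive; ≤-trans; m≤n⇒m≤1+n; m∸n+n≡m; module ≤-Reasoning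
        ; +-suc; +-mono-≤; +-monoˡ-≤; *-suc; *-distribʳ-+; *-monoˡ-≤)
open import Data.Product.Base using (∃; _×_; _,_)
open import Data.Rational.Properties using (toℚᵘ-cancel-≤; toℚᵘ-fromℚᵘ)
open import Data.Rational.Unnormalised.Base using (mkℚᵘ; *≤*)
import Data.Rational.Unnormalised.Properties as ℚᵘ
open import Data.Vec.Base using ([]; _∷_; tabulate; there)
open import Data.Vec.Properties using ([]=⇒lookup; lookup⇒[]=; lookup∘tabulate)
open import Function.Base using (_∘_)
open import Relation.Binary.PropositionalEquality
  using (_≡_; sym; trans; cong; subst; subst₂)
open import Relation.Nullary.Decidable using (does; yes; no; dec-true)
open import Relation.Nullary.Negation using (¬_; contradiction)
open import Relation.Unary using (Pred; Decidable)

module _ {n p} {P : Pred (Fin n) p} (P? : Decidable P) where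

  -- `N` and `Odd` are both tabulated from decision procedures; this and its converse move between
  -- membership and the decided predicate. Under `no` the lookup equation would identify `outside`
  -- with `inside`, so only `yes` remains.
  ∈-tabulate⁻ : ∀ {i} → i ∈ tabulate (does ∘ P?) → P i
  ∈-tabulate⁻ {i} i∈ with P? i | trans (sym (lookup∘tabulate (does ∘ P?) i)) ([]=⇒lookup i∈)
  ... | yes Pi | _ = Pi

  ∈-tabulate⁺ : ∀ {i} → P i → i ∈ tabulate (does ∘ P?)
  ∈-tabulate⁺ {i} Pi = lookup⇒[]= i _
    (trans (lookup∘tabulate (does ∘ P?) i) (dec-true (P? i) Pi))

∣p∣≤∣q∣+∣p∩∁q∣ : ∀ {n} (p q : Subset n) → ∣ p ∣ ℕ.≤ ∣ q ∣ ℕ.+ ∣ p ∩ ∁ q ∣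
∣p∣≤∣q∣+∣p∩∁q∣ []            []            = ℕ.z≤n
∣p∣≤∣q∣+∣p∩∁q∣ (outside ∷ p) (outside ∷ q) = ∣p∣≤∣q∣+∣p∩∁q∣ p q
∣p∣≤∣q∣+∣p∩∁q∣ (outside ∷ p) (inside ∷ q)  = m≤n⇒m≤1+n (∣p∣≤∣q∣+∣p∩∁q∣ p q)
∣p∣≤∣q∣+∣p∩∁q∣ (inside ∷ p)  (inside ∷ q)  = ℕ.s≤s (∣p∣≤∣q∣+∣p∩∁q∣ p q)
∣p∣≤∣q∣+∣p∩∁q∣ (inside ∷ p)  (outside ∷ q) =
  ≤-trans (ℕ.s≤s (∣p∣≤∣q∣+∣p∩∁q∣ p q)) (≤-reflexive (sym (+-suc ∣ q ∣ _)))

-- A union bound, by recursion on `C`. The indices and the covered points live in separate types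
-- because the recursion drops indices while the ground set stays fixed; the graph application takes
-- `m` equal to `n`.
cover-bound : ∀ {m n d} (f : Fin m → Subset n) → (∀ i → ∣ f i ∣ ℕ.≤ d) →
              (C : Subset m) (B : Subset n) →
              (∀ {x} → x ∈ B → ∃ λ i → i ∈ C × x ∈ f i) →
              ∣ B ∣ ℕ.≤ ∣ C ∣ ℕ.* d
cover-bound {n = n} f f≤d [] B cover =
  ≤-reflexive (trans (cong ∣_∣ (Empty-unique λ (_ , x∈B) → no-cover (cover x∈B))) (∣⊥∣≡0 n))
  where
  no-cover : ∀ {x} → ¬ (∃ λ i → i ∈ [] × x ∈ f i)
  no-cover (() , _)
cover-bound f f≤d (outside ∷ C) B cover = cover-bound (f ∘ suc) (f≤d ∘ suc) C B cover′
  where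
  cover′ : ∀ {x} → x ∈ B → ∃ λ i → i ∈ C × x ∈ f (suc i)
  cover′ x∈B with cover x∈B
  ... | suc i , there i∈C , x∈fi = i , i∈C , x∈fi
-- `f zero` accounts for at most `d` points of `B`; what it misses has to be covered by the later
-- indices.
cover-bound {d = d} f f≤d (inside ∷ C) B cover = begin
  ∣ B ∣                               ≤⟨ ∣p∣≤∣q∣+∣p∩∁q∣ B (f zero) ⟩
  ∣ f zero ∣ ℕ.+ ∣ B ∩ ∁ (f zero) ∣   ≤⟨ +-mono-≤ (f≤d zero)
                                         (cover-bound (f ∘ suc) (f≤d ∘ suc) C _ cover′) ⟩
  d ℕ.+ ∣ C ∣ ℕ.* d                   ∎
  where
  open ≤-Reasoning
  cover′ : ∀ {x} → x ∈ B ∩ ∁ (f zero) → ∃ λ i → i ∈ C × x ∈ f (suc i)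
  cover′ x∈ with x∈p∩q⁻ B _ x∈
  ... | x∈B , x∈∁f₀ with cover x∈B
  ...   | zero  , _         , x∈f₀ = contradiction x∈f₀ (x∈∁p⇒x∉p x∈∁f₀)
  ...   | suc i , there i∈C , x∈fi = i , i∈C , x∈fi

odd⇒nonempty : ∀ {n} (p : Subset n) → ∣ p ∣ ℕ.% 2 ≡ 1 → Nonempty p
odd⇒nonempty {n} p odd with nonempty? p
... | yes ne = ne
... | no ¬ne = contradiction
  (trans (sym odd) (cong (ℕ._% 2) (trans (cong ∣_∣ (Empty-unique ¬ne)) (∣⊥∣≡0 n)))) λ ()

module _ {n} (G : Graph n) where
  open Graph G

  ∈N-sym : ∀ {u v} → u ∈ N G v → v ∈ N G u
  ∈N-sym {u} {v} = ∈-tabulate⁺ (u ~?_) ∘ ~-sym ∘ ∈-tabulate⁻ (v ~?_)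

  -- Oddness supplies a common element of `N G v` and `C`; symmetry of adjacency then puts `v` in
  -- that element's neighbourhood, the form in which `cover-bound` takes its hypothesis.
  odd-dominated : ∀ {C v} → v ∈ Odd G C → ∃ λ c → c ∈ C × v ∈ N G c
  odd-dominated {C} {v} v∈ with odd⇒nonempty (N G v ∩ C)
    (∈-tabulate⁻ (λ v → ∣ N G v ∩ C ∣ ℕ.% 2 ≟ 1) v∈)
  ... | c , c∈ with x∈p∩q⁻ (N G v) C c∈
  ...   | c∈N , c∈C = c , c∈C , ∈N-sym c∈N

  WOD-bound : ∀ B → WOD G B → ∣ B ∣ ℕ.* suc (Δ G) ℕ.≤ n ℕ.* Δ G
  WOD-bound B (C , C⊆∁B , B⊆OddC) = begin
    ∣ B ∣ ℕ.* suc (Δ G)             ≡⟨ *-suc ∣ B ∣ (Δ G) ⟩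
    -- Only the single copy of `∣ B ∣` split off by `*-suc` is bounded through the cover; the other
    -- `Δ G` copies are kept, to be merged with those of `∣ C ∣`.
    ∣ B ∣ ℕ.+ ∣ B ∣ ℕ.* Δ G         ≤⟨ +-monoˡ-≤ _ (cover-bound (N G) (degree≤Δ G) C B
                                       (odd-dominated ∘ B⊆OddC)) ⟩
    ∣ C ∣ ℕ.* Δ G ℕ.+ ∣ B ∣ ℕ.* Δ G ≡⟨ *-distribʳ-+ (Δ G) ∣ C ∣ ∣ B ∣ ⟨
    (∣ C ∣ ℕ.+ ∣ B ∣) ℕ.* Δ G       ≤⟨ *-monoˡ-≤ (Δ G) (+-monoˡ-≤ ∣ B ∣ (p⊆q⇒∣p∣≤∣q∣ C⊆∁B)) ⟩
    (∣ ∁ B ∣ ℕ.+ ∣ B ∣) ℕ.* Δ G     ≡⟨ cong (λ k → (k ℕ.+ ∣ B ∣) ℕ.* Δ G) (∣∁p∣≡n∸∣p∣ B) ⟩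
    (n ℕ.∸ ∣ B ∣ ℕ.+ ∣ B ∣) ℕ.* Δ G ≡⟨ cong (ℕ._* Δ G) (m∸n+n≡m (∣p∣≤n B)) ⟩
    n ℕ.* Δ G                       ∎
    where open ≤-Reasoning

  -- The maximum is attained by some WOD set, so the bound on every such set passes to `κ G`.
  κ-bound : κ G ℕ.* suc (Δ G) ℕ.≤ n ℕ.* Δ G
  κ-bound with κ-attained G
  ... | B , wod , ∣B∣≡κ = subst (λ k → k ℕ.* suc (Δ G) ℕ.≤ n ℕ.* Δ G) ∣B∣≡κ (WOD-bound B wod)

-- Fractions in `ℚ` are reduced to lowest terms, which hides `m`, `k` and `suc d`. Passing to
-- unnormalised rationals turns the order into cross-multiplication of the given numbers.
m*d≤k⇒m/1≤k/d : ∀ m k d → m ℕ.* suc d ℕ.≤ k → (+ m) / 1 ≤ (+ k) / suc d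
m*d≤k⇒m/1≤k/d m k d m*d≤k = toℚᵘ-cancel-≤ (begin
  _                ≃⟨ toℚᵘ-fromℚᵘ (mkℚᵘ (+ m) 0) ⟩
  -- `mkℚᵘ` stores the denominator minus one, so `0` and `d` stand for denominators `1` and `suc d`;
  -- the right-hand product is therefore `+ k` times one.
  mkℚᵘ (+ m) 0     ≤⟨ *≤* (subst₂ ℤ._≤_ (ℤ.pos-* m (suc d)) (sym (ℤ.*-identityʳ (+ k))) (ℤ.+≤+ m*d≤k)) ⟩
  mkℚᵘ (+ k) d     ≃⟨ toℚᵘ-fromℚᵘ (mkℚᵘ (+ k) d) ⟨
  _                ∎)
  where open ℚᵘ.≤-Reasoning

lemma4 : (n : ℕ) → n ℕ.≥ 1 → (G : Graph n) →
    (+ κ G) / 1 ≤ (+ (n ℕ.* Δ G)) / suc (Δ G)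
lemma4 n _ G = m*d≤k⇒m/1≤k/d (κ G) (n ℕ.* Δ G) (Δ G) (κ-bound G)
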